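{- Let $n\ge 3$, $1\le t<n$, and let $c_1,c_2,\ldots,c_t\in[n]$ be distinct integers such that the sequence $(c_1,\ldots,c_t)$ avoids both patterns $123$ and $132$. Write $\alpha=\max([n]\setminus\{c_1,\ldots,c_t\})$. If $\{c_1,c_2,\ldots,c_{n-\alpha}\}\neq\{\alpha+1,\alpha+2,\ldots,n\}$ or $(c_{n-\alpha+1},c_{n-\alpha+2},\ldots,c_t)\neq(\alpha-1,\alpha-2,\ldots,n-t)$, then $|S_{n,(c_1,\ldots,c_t)}(123,132)|=0$; otherwise, $$|S_{n,(c_1,\ldots,c_t)}(123,132)|=2^{n-t-1}.$$
   Context: $[n]=\{1,\ldots,n\}$ and $S_n$ is the set of permutations of $[n]$ written as sequences $(\tau(1),\ldots,\tau(n))$. A sequence of distinct integers $\tau=(\tau(1),\ldots,\tau(m))$ contains $\sigma\in S_k$ as a pattern if there are indices $1\le i_1<\cdots<i_k\le m$ such that for all $1\le a<b\le k$, $\tau(i_a)<\tau(i_b)$ if and only if $\sigma(a)<\sigma(b)$; otherwise $\tau$ avoids $\sigma$. $S_{n,(c_1,\ldots,c_t)}(\sigma_1,\ldots,\sigma_m)$ is the set of $\tau\in S_n$ with $(\tau(1),\ldots,\tau(t))=(c_1,\ldots,c_t)$ that avoid all of $\sigma_1,\ldots,\sigma_m$. One always has $\alpha\ge n-t$. Both $(c_{n-\alpha+1},\ldots,c_t)$ and $(\alpha-1,\alpha-2,\ldots,n-t)$ are understood as sequences of length $t-(n-\alpha)$; when $\alpha=n-t$ both are empty, hence equal (and then $\{c_1,\ldots,c_t\}=\{n-t+1,\ldots,n\}$).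 When $\alpha=n$, the sets $\{c_1,\ldots,c_{n-\alpha}\}$ and $\{\alpha+1,\ldots,n\}$ are both empty, hence equal. -}

module Defs where

open import Data.Fin using (Fin) renaming (_<_ to _<ᶠ_)
open import Data.List using (List; []; _∷_; length; lookup; take; filter; applyUpTo)
open import Data.List.Extrema.Nat using (max)
open import Data.List.Membership.DecPropositional using (_∉?_)
open import Data.List.Membership.Propositional using (_∈_)
open import Data.List.Relation.Binary.Permutation.Propositional using (_↭_)
open import Data.List.Relation.Unary.All using (All)
open import Data.List.Relation.Unary.Unique.Propositional using (Unique)
open import Data.Nat using (ℕ; suc; _+_; _∸_; _<_; _≟_)
open import Data.Product using (_×_; ∃-syntax)
open import Function using (_⇔_)
open import Relation.Binary.Core using (_Preserves_⟶_)
open import Relation.Binary.PropositionalEquality using (_≡_)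
open import Relation.Nullary using (¬_)
open import Relation.Unary using (Pred)
open import Level using (0ℓ)

-- The list a , a + 1 , … , b, which is empty when b < a.
[_⋯_] : ℕ → ℕ → List ℕ
[ a ⋯ b ] = applyUpTo (a +_) (suc b ∸ a)

-- The indices i₁ < ⋯ < iₖ are the values of the strictly increasing map i.
_Contains_ : List ℕ → List ℕ → Set
τ Contains σ =
  ∃[ i ] (i Preserves _<ᶠ_ ⟶ _<ᶠ_) ×
    (∀ (a b : Fin (length σ)) → a <ᶠ b →
      (lookup τ (i a) < lookup τ (i b)) ⇔ (lookup σ a < lookup σ b))

_Avoids_ : List ℕ → List ℕ → Set
τ Avoids σ = ¬ (τ Contains σ)

-- The set S_{n,(c₁,…,cₜ)}(σ₁,…,σₘ), where c lists the prescribed prefix and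
-- σs the forbidden patterns; an element is the sequence τ(1) , … , τ(n).
S : ℕ → List ℕ → List (List ℕ) → Pred (List ℕ) 0ℓ
S n c σs τ = τ ↭ [ 1 ⋯ n ] × take (length c) τ ≡ c × All (τ Avoids_) σs

-- ∣ P ∣≡ k : some list enumerates the elements satisfying P, each exactly
-- once, and has length k.  A bijection between Fin k and the Σ-type of P would
-- instead count proofs of P, which need not be unique.
∣_∣≡_ : {A : Set} → Pred A 0ℓ → ℕ → Set
∣ P ∣≡ k = ∃[ xs ] Unique xs × (∀ x → x ∈ xs ⇔ P x) × length xs ≡ k

-- max ([n] ∖ {c₁,…,cₜ}).  The value 0 is a default, taken only when the
-- difference is empty, which cannot happen if c has fewer than n entries.
maxMissing : ℕ → List ℕ → ℕ
maxMissing n c = max 0 (filter (λ x → _∉?_ _≟_ x c) [ 1 ⋯ n ])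

p123 p132 : List ℕ
p123 = 1 ∷ 2 ∷ 3 ∷ []
p132 = 1 ∷ 3 ∷ 2 ∷ []

{-# OPTIONS --safe #-}
module Submission where

-- In both patterns the first entry is the smallest, so τ avoids 123 and 132
-- exactly when every entry has at most one larger entry to its right.  Suppose
-- τ has this property.  As α comes after the prefix c, a prefix entry x < α has
-- only entries ≤ x besides α to its right; so c lists all values above α first
-- and then descends from α − 1 without gaps.  Conversely, such a prefix imposes
-- no condition on the remaining entries α, n − t − 1, …, 1, and an arrangement
-- of these has the property iff it begins with one of the two largest and the
-- rest has the property again, which leaves two choices for each entry but the
-- last.

open import Defs
open import Data.Fin using (Fin; zero; suc) renaming (_<_ to _<ᶠ_)
open import Data.List using (List; []; _∷_; _++_; length; lookup; map; filter; take; drop;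
  reverse; applyDownFrom)
open import Data.List.Extrema.Nat using (argmax-sel; xs≤max)
open import Data.List.Membership.DecPropositional using (_∈?_; _∉?_)
open import Data.List.Membership.Propositional using (_∈_; _∉_)
open import Data.List.Membership.Propositional.Properties
open import Data.List.Membership.Propositional.Properties.WithK using (unique∧set⇒bag)
open import Data.List.Properties
open import Data.List.Relation.Binary.BagAndSetEquality using (_∼[_]_; set; ∼bag⇒↭)
open import Data.List.Relation.Binary.Permutation.Propositional
  using (_↭_; ↭-refl; ↭-sym; ↭-trans; ↭-prep; ↭-swap; ↭-reflexive; ↭⇒↭ₛ;
    module PermutationReasoning)
open import Data.List.Relation.Binary.Permutation.Propositional.Properties
  using (∈-resp-↭; All-resp-↭; ↭-length; ↭-reverse; ↭-singleton-inv; shift; drop-∷;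
    ++⁺ˡ; ++⁺ʳ; ¬x∷xs↭[])
import Data.List.Relation.Binary.Permutation.Setoid.Properties as ↭ₛ
open import Data.List.Relation.Unary.All as All using (All; []; _∷_)
import Data.List.Relation.Unary.All.Properties as All
open import Data.List.Relation.Unary.AllPairs as AllPairs using (AllPairs; []; _∷_)
import Data.List.Relation.Unary.AllPairs.Properties as AllPairs
open import Data.List.Relation.Unary.Any using (here; there)
open import Data.List.Relation.Unary.Unique.Propositional using (Unique)
import Data.List.Relation.Unary.Unique.Propositional.Properties as Unique
open import Data.Nat using (ℕ; zero; suc; _+_; _∸_; _*_; _^_; _≤_; _<_;
  z≤n; s≤s; z<s; s<s; _<?_; _≟_)
open import Data.Nat.Properties
open import Data.Product using (_×_; _,_; ∃-syntax; proj₁; proj₂)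
open import Data.Sum as Sum using (_⊎_; inj₁; inj₂)
open import Function using (_∘_; _⇔_; mk⇔; Equivalence; id)
open import Relation.Binary.Core using (_Preserves_⟶_)
open import Relation.Binary.Definitions using (Symmetric; tri<; tri≈; tri>)
open import Relation.Binary.PropositionalEquality
open import Relation.Nullary using (¬_; yes; no; contradiction)
open import Relation.Nullary.Decidable using (decidable-stable)

private
  variable
    A : Set

-- Pairwise relations and permutations of lists

AllPairs-lookup⁻ : {R : A → A → Set} {xs : List A} → AllPairs R xs →
  {i j : Fin (length xs)} → i <ᶠ j → R (lookup xs i) (lookup xs j)
AllPairs-lookup⁻ (px ∷ _) {zero} {suc j} _ = All.lookup px (∈-lookup j)
AllPairs-lookup⁻ (_ ∷ pxs) {suc _} {suc _} (s<s i<j) = AllPairs-lookup⁻ pxs i<j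

AllPairs-lookup⁺ : {R : A → A → Set} (xs : List A) →
  (∀ {i j} → i <ᶠ j → R (lookup xs i) (lookup xs j)) → AllPairs R xs
AllPairs-lookup⁺ xs f = subst (AllPairs _) (tabulate-lookup xs) (AllPairs.tabulate⁺-< f)

AllPairs-resp-↭ : {R : A → A → Set} → Symmetric R → {xs ys : List A} →
  xs ↭ ys → AllPairs R xs → AllPairs R ys
AllPairs-resp-↭ {R = R} sym-R xs↭ys =
  ↭ₛ.AllPairs-resp-↭ (setoid _) sym-R (resp₂ R) (↭⇒↭ₛ xs↭ys)

++-cancelˡ-↭ : (xs : List A) {ys zs : List A} → xs ++ ys ↭ xs ++ zs → ys ↭ zs
++-cancelˡ-↭ []       ρ = ρ
++-cancelˡ-↭ (x ∷ xs) ρ = ++-cancelˡ-↭ xs (drop-∷ ρ)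

∈⇒↭∷ : {x : A} {xs : List A} → x ∈ xs → ∃[ ys ] xs ↭ x ∷ ys
∈⇒↭∷ {x = x} x∈xs with ys , zs , refl ← ∈-∃++ x∈xs = ys ++ zs , shift x ys zs

-- Patterns

-- The bound is put on pairs of positions by a symmetric relation, so it is invariant under
-- permutation of the list.
AtMostOneAbove : ℕ → List ℕ → Set
AtMostOneAbove x = AllPairs (λ y z → ¬ (x < y × x < z))

-- Avoidance of both 123 and 132 as a recursive condition on the list, free of index maps;
-- `Avoids⇒Sparse` and `Sparse⇒Avoids` relate the two.
data Sparse : List ℕ → Set where
  []  : Sparse []
  _∷_ : ∀ {x xs} → AtMostOneAbove x xs → Sparse xs → Sparse (x ∷ xs)

AtMostOneAbove-resp-↭ : ∀ {x xs ys} → xs ↭ ys → AtMostOneAbove x xs → AtMostOneAbove x ys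
AtMostOneAbove-resp-↭ = AllPairs-resp-↭ (λ ¬p (x<y , x<z) → ¬p (x<z , x<y))

all≤⇒AtMostOneAbove : ∀ {x xs} → All (_≤ x) xs → AtMostOneAbove x xs
all≤⇒AtMostOneAbove []            = []
all≤⇒AtMostOneAbove (y≤x ∷ xs≤x) =
  All.universal (λ _ (x<y , _) → <⇒≱ x<y y≤x) _ ∷ all≤⇒AtMostOneAbove xs≤x

Descending : List ℕ → Set
Descending = AllPairs (λ x y → y < x)

Descending⇒AtMostOneAbove : ∀ {a b xs} → Descending (a ∷ b ∷ xs) → AtMostOneAbove b (a ∷ xs)
Descending⇒AtMostOneAbove (_ ∷ b>xs ∷ _) =
  All.map (λ y<b (_ , b<y) → <-asym y<b b<y) b>xs ∷ all≤⇒AtMostOneAbove (All.map <⇒≤ b>xs)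

-- `a` already is the one entry allowed above `x`; moving it to the front pairs it with every entry
-- of `ys`.
AtMostOneAbove⇒all≤ : ∀ {x a xs ys} → x < a → xs ↭ a ∷ ys → AtMostOneAbove x xs → All (_≤ x) ys
AtMostOneAbove⇒all≤ x<a ρ s =
  All.map (λ ¬p → ≮⇒≥ (λ x<y → ¬p (x<a , x<y))) (AllPairs.head (AtMostOneAbove-resp-↭ ρ s))

Sparse-++⁻ʳ : ∀ xs {ys} → Sparse (xs ++ ys) → Sparse ys
Sparse-++⁻ʳ []       s       = s
Sparse-++⁻ʳ (_ ∷ xs) (_ ∷ s) = Sparse-++⁻ʳ xs s

-- No entry of `xs` is exceeded by anything in `ys`, so its larger entries to the right all lie in
-- `xs`.
Sparse-++⁺ : ∀ {xs ys} → Sparse xs → Sparse ys → All (λ x → All (_≤ x) ys) xs → Sparse (xs ++ ys)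
Sparse-++⁺ []       s′ []              = s′
Sparse-++⁺ {x ∷ xs} (p ∷ s) s′ (ys≤x ∷ ys≤xs) =
  AllPairs.++⁺ p (all≤⇒AtMostOneAbove ys≤x)
    (All.universal (λ _ → All.map (λ z≤x (_ , x<z) → <⇒≱ x<z z≤x) ys≤x) xs)
  ∷ Sparse-++⁺ s s′ ys≤xs

Sparse-lookup : ∀ {τ} → Sparse τ → ∀ {i j k} → i <ᶠ j → j <ᶠ k →
  ¬ (lookup τ i < lookup τ j × lookup τ i < lookup τ k)
Sparse-lookup (p ∷ _) {zero}  {suc _} {suc _} _         (s<s j<k) = AllPairs-lookup⁻ p j<k
Sparse-lookup (_ ∷ s) {suc _} {suc _} {suc _} (s<s i<j) (s<s j<k) = Sparse-lookup s i<j j<k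

-- An occurrence would place two larger entries to the right of the one playing `a`. This covers 123
-- and 132 at once.
Sparse⇒Avoids : ∀ {τ a b c} → Sparse τ → a < b → a < c → τ Avoids (a ∷ b ∷ c ∷ [])
Sparse⇒Avoids s a<b a<c (i , mono , iff) =
  Sparse-lookup s (mono {zero} {suc zero} z<s) (mono {suc zero} {suc (suc zero)} (s<s z<s))
    ( Equivalence.from (iff zero (suc zero) z<s) a<b
    , Equivalence.from (iff zero (suc (suc zero)) z<s) a<c )

Contains-∷ : ∀ {x τ σ} → τ Contains σ → (x ∷ τ) Contains σ
Contains-∷ (i , mono , iff) = suc ∘ i , s<s ∘ mono , iff

contains₃ : ∀ {τ a b c} {i j k : Fin (length τ)} → i <ᶠ j → j <ᶠ k →
  (lookup τ i < lookup τ j) ⇔ (a < b) → (lookup τ i < lookup τ k) ⇔ (a < c) →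
  (lookup τ j < lookup τ k) ⇔ (b < c) → τ Contains (a ∷ b ∷ c ∷ [])
contains₃ {τ} {a} {b} {c} {i} {j} {k} i<j j<k ab ac bc = f , mono , iff
  where
  f : Fin 3 → Fin (length τ)
  f = lookup (i ∷ j ∷ k ∷ [])

  mono : f Preserves _<ᶠ_ ⟶ _<ᶠ_
  mono {zero}     {suc zero}       _ = i<j
  mono {zero}     {suc (suc zero)} _ = <-trans i<j j<k
  mono {suc zero} {suc (suc zero)} _ = j<k
  mono {suc zero} {suc zero} (s<s ())
  mono {suc (suc zero)} {suc zero} (s<s ())
  mono {suc (suc zero)} {suc (suc zero)} (s<s (s<s ()))

  iff : ∀ u v → u <ᶠ v → (lookup τ (f u) < lookup τ (f v)) ⇔
    (lookup (a ∷ b ∷ c ∷ []) u < lookup (a ∷ b ∷ c ∷ []) v)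
  iff zero       (suc zero)       _ = ab
  iff zero       (suc (suc zero)) _ = ac
  iff (suc zero) (suc (suc zero)) _ = bc
  iff (suc zero) (suc zero) (s<s ())
  iff (suc (suc zero)) (suc zero) (s<s ())
  iff (suc (suc zero)) (suc (suc zero)) (s<s (s<s ()))

-- Two larger entries to the right of `x` form a 123 with it if they ascend, and a 132 otherwise.
Avoids⇒Sparse : ∀ τ → τ Avoids p123 → τ Avoids p132 → Sparse τ
Avoids⇒Sparse []      _    _    = []
Avoids⇒Sparse (x ∷ τ) ¬123 ¬132 =
  AllPairs-lookup⁺ τ no-two ∷ Avoids⇒Sparse τ (¬123 ∘ Contains-∷) (¬132 ∘ Contains-∷)
  where
  1<2 : 1 < 2
  1<2 = s<s z<s
  1<3 : 1 < 3
  1<3 = s<s z<s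
  no-two : ∀ {i j} → i <ᶠ j → ¬ (x < lookup τ i × x < lookup τ j)
  no-two {i} {j} i<j (x<y , x<z) with lookup τ i <? lookup τ j
  ... | yes y<z = ¬123 (contains₃ {i = zero} {suc i} {suc j} z<s (s<s i<j)
    (mk⇔ (λ _ → 1<2) (λ _ → x<y)) (mk⇔ (λ _ → 1<3) (λ _ → x<z)) (mk⇔ (λ _ → s<s (s<s z<s)) (λ _ → y<z)))
  -- Equal entries land here too: `Contains` only asks that `y < z` fail, just as `3 < 2` does.
  ... | no  y≮z = ¬132 (contains₃ {i = zero} {suc i} {suc j} z<s (s<s i<j)
    (mk⇔ (λ _ → 1<3) (λ _ → x<y)) (mk⇔ (λ _ → 1<2) (λ _ → x<z))
    (mk⇔ (λ y<z → contradiction y<z y≮z) (λ { (s<s (s<s ())) })))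

-- Enumeration

-- For descending a ∷ xs; a sparse list starts with one of its two largest entries.
sparsePerms : ℕ → List ℕ → List (List ℕ)
sparsePerms a []       = (a ∷ []) ∷ []
sparsePerms a (b ∷ xs) = map (a ∷_) (sparsePerms b xs) ++ map (b ∷_) (sparsePerms a xs)

length-sparsePerms : ∀ a xs → length (sparsePerms a xs) ≡ 2 ^ length xs
length-sparsePerms a []       = refl
length-sparsePerms a (b ∷ xs) = begin
  length (map (a ∷_) (sparsePerms b xs) ++ map (b ∷_) (sparsePerms a xs))
    ≡⟨ length-++ (map (a ∷_) (sparsePerms b xs)) ⟩
  length (map (a ∷_) (sparsePerms b xs)) + length (map (b ∷_) (sparsePerms a xs))
    ≡⟨ cong₂ _+_ (trans (length-map _ (sparsePerms b xs)) (length-sparsePerms b xs))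
                 (trans (length-map _ (sparsePerms a xs)) (length-sparsePerms a xs)) ⟩
  2 ^ length xs + 2 ^ length xs
    ≡⟨ cong (2 ^ length xs +_) (+-identityʳ _) ⟨
  2 * 2 ^ length xs ∎
  where open ≡-Reasoning

Descending-drop₂ : ∀ {a b xs} → Descending (a ∷ b ∷ xs) → Descending (a ∷ xs)
Descending-drop₂ ((_ ∷ a>xs) ∷ _ ∷ d) = a>xs ∷ d

sparsePerms-unique : ∀ a xs → Descending (a ∷ xs) → Unique (sparsePerms a xs)
sparsePerms-unique a []       _ = [] ∷ []
sparsePerms-unique a (b ∷ xs) d@((b<a ∷ _) ∷ d′) = Unique.++⁺
  (Unique.map⁺ ∷-injectiveʳ (sparsePerms-unique b xs d′))
  (Unique.map⁺ ∷-injectiveʳ (sparsePerms-unique a xs (Descending-drop₂ d)))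
  disjoint
  where
  disjoint : ∀ {ws} → ¬ (ws ∈ map (a ∷_) (sparsePerms b xs) × ws ∈ map (b ∷_) (sparsePerms a xs))
  disjoint (p , q) with ∈-map⁻ _ p | ∈-map⁻ _ q
  ... | _ , _ , refl | _ , _ , eq = <-irrefl (sym (∷-injectiveˡ eq)) b<a

-- Nothing exceeds a leading `a`, the maximum, and only `a` exceeds a leading `b`, the second
-- largest.
sparsePerms-sound : ∀ a xs → Descending (a ∷ xs) → ∀ {w} → w ∈ sparsePerms a xs → w ↭ a ∷ xs × Sparse w
sparsePerms-sound a []       _ (here refl) = ↭-refl , [] ∷ []
sparsePerms-sound a (b ∷ xs) d@((b<a ∷ a>xs) ∷ d′) w∈
  with ∈-++⁻ (map (a ∷_) (sparsePerms b xs)) w∈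
... | inj₁ p with v , v∈ , refl ← ∈-map⁻ _ p
  with ρ , s ← sparsePerms-sound b xs d′ v∈ =
  ↭-prep a ρ , all≤⇒AtMostOneAbove (All-resp-↭ (↭-sym ρ) (All.map <⇒≤ (b<a ∷ a>xs))) ∷ s
... | inj₂ p with v , v∈ , refl ← ∈-map⁻ _ p
  with ρ , s ← sparsePerms-sound a xs (Descending-drop₂ d) v∈ =
  ↭-trans (↭-prep b ρ) (↭-swap b a ↭-refl) ,
  AtMostOneAbove-resp-↭ (↭-sym ρ) (Descending⇒AtMostOneAbove d) ∷ s

sparsePerms-complete : ∀ a xs → Descending (a ∷ xs) → ∀ {w} → w ↭ a ∷ xs → Sparse w → w ∈ sparsePerms a xs
sparsePerms-complete a []       _ ρ _ = here (↭-singleton-inv ρ)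
sparsePerms-complete a (b ∷ xs) _ ρ [] = contradiction (↭-sym ρ) ¬x∷xs↭[]
sparsePerms-complete a (b ∷ xs) d@((b<a ∷ _) ∷ d′) {x ∷ w} ρ (p ∷ s) with ∈-resp-↭ ρ (here refl)
... | here refl = ∈-++⁺ˡ (∈-map⁺ _ (sparsePerms-complete b xs d′ (drop-∷ ρ) s))
... | there (here refl) = ∈-++⁺ʳ (map (a ∷_) (sparsePerms b xs))
  (∈-map⁺ _ (sparsePerms-complete a xs (Descending-drop₂ d)
    (drop-∷ (↭-trans ρ (↭-swap a b ↭-refl))) s))
-- Any other first entry would have both `a` and `b` above it on its right.
... | there (there x∈xs) = contradiction (x<a , x<b) (All.lookup (AllPairs.head twoAbove) (here refl))
  where
  x<b : x < b
  x<b = All.lookup (AllPairs.head d′) x∈xs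
  x<a : x < a
  x<a = <-trans x<b b<a
  twoAbove : AtMostOneAbove x (a ∷ b ∷ xs)
  -- `ρ` permutes `x ∷ w`, so `x` is first added to `w`; this is harmless, since `x` is not above
  -- itself.
  twoAbove = AtMostOneAbove-resp-↭ ρ (All.universal (λ _ (x<x , _) → <-irrefl refl x<x) w ∷ p)

-- Intervals

∈-interval⁺ : ∀ {a b x} → a ≤ x → x ≤ b → x ∈ [ a ⋯ b ]
∈-interval⁺ {a} {b} {x} a≤x x≤b =
  subst (_∈ [ a ⋯ b ]) (m+[n∸m]≡n a≤x) (∈-applyUpTo⁺ (a +_) (∸-monoˡ-< (s≤s x≤b) a≤x))

∈-interval⁻ : ∀ {a b x} → x ∈ [ a ⋯ b ] → a ≤ x × x ≤ b
∈-interval⁻ {a} {b} x∈ with i , i< , refl ← ∈-applyUpTo⁻ (a +_) x∈ | ≤-total a (suc b)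
... | inj₁ a≤1+b = m≤m+n a i , ≤-pred (subst (a + i <_) (m+[n∸m]≡n a≤1+b) (+-monoʳ-< a i<))
... | inj₂ 1+b≤a = contradiction (subst (i <_) (m≤n⇒m∸n≡0 1+b≤a) i<) λ ()

interval-unique : ∀ a b → Unique [ a ⋯ b ]
interval-unique a b = Unique.applyUpTo⁺₁ _ (suc b ∸ a) (λ i<j _ eq → <⇒≢ i<j (+-cancelˡ-≡ a _ _ eq))

reverse-interval : ∀ a b → reverse [ a ⋯ b ] ≡ applyDownFrom (a +_) (suc b ∸ a)
reverse-interval a b = reverse-applyUpTo (a +_) (suc b ∸ a)

-- `applyDownFrom suc k` is k, ..., 1 and `applyDownFrom (suc k +_) l` is k + l, ..., k + 1, so they
-- join without a gap.
applyDownFrom-suc-++ : ∀ k l → applyDownFrom (suc k +_) l ++ applyDownFrom suc k ≡ applyDownFrom suc (l + k)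
applyDownFrom-suc-++ k zero    = refl
applyDownFrom-suc-++ k (suc l) = cong₂ _∷_ (cong suc (+-comm k l)) (applyDownFrom-suc-++ k l)

All-applyDownFrom-suc : ∀ m → All (_≤ m) (applyDownFrom suc m)
All-applyDownFrom-suc m = All.applyDownFrom⁺₁ suc m id

Descending-applyDownFrom-suc : ∀ m → Descending (applyDownFrom suc m)
Descending-applyDownFrom-suc m = AllPairs.applyDownFrom⁺₁ suc m (λ j<i _ → s<s j<i)

interval-↭ : ∀ {α n} → α ≤ n → [ 1 ⋯ n ] ↭ [ suc α ⋯ n ] ++ applyDownFrom suc α
interval-↭ {α} {n} α≤n = begin
  [ 1 ⋯ n ]                                              ↭⟨ ↭-reverse [ 1 ⋯ n ] ⟨
  reverse [ 1 ⋯ n ]                                      ≡⟨ reverse-interval 1 n ⟩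
  applyDownFrom suc n                                    ≡⟨ cong (applyDownFrom suc) (m∸n+n≡m α≤n) ⟨
  applyDownFrom suc (n ∸ α + α)                          ≡⟨ applyDownFrom-suc-++ α (n ∸ α) ⟨
  applyDownFrom (suc α +_) (n ∸ α) ++ applyDownFrom suc α
    ≡⟨ cong (_++ applyDownFrom suc α) (reverse-interval (suc α) n) ⟨
  reverse [ suc α ⋯ n ] ++ applyDownFrom suc α           ↭⟨ ++⁺ʳ _ (↭-reverse [ suc α ⋯ n ]) ⟩
  [ suc α ⋯ n ] ++ applyDownFrom suc α                   ∎
  where open PermutationReasoning

length-interval : ∀ α n → length [ suc α ⋯ n ] ≡ n ∸ α
length-interval α n = length-applyUpTo (suc α +_) (n ∸ α)

unique∧set⇒↭ : {xs ys : List A} → Unique xs → Unique ys → xs ∼[ set ] ys → xs ↭ ys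
unique∧set⇒↭ u v eq = ∼bag⇒↭ (unique∧set⇒bag u v eq)

-- The largest missing value

maxMissing-upper : ∀ {n c x} → x ∈ [ 1 ⋯ n ] → x ∉ c → x ≤ maxMissing n c
maxMissing-upper {n} {c} x∈ x∉c =
  All.lookup (xs≤max 0 _) (∈-filter⁺ (λ x → _∉?_ _≟_ x c) x∈ x∉c)

-- The first alternative is the default value of `max`; `maxMissing-missing` rules it out.
maxMissing-sel : ∀ n c → maxMissing n c ≡ 0 ⊎ (maxMissing n c ∈ [ 1 ⋯ n ] × maxMissing n c ∉ c)
maxMissing-sel n c with argmax-sel id 0 (filter (λ x → _∉?_ _≟_ x c) [ 1 ⋯ n ])
... | inj₁ eq = inj₁ eq
... | inj₂ m∈ = inj₂ (∈-filter⁻ (λ x → _∉?_ _≟_ x c) m∈)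

maxMissing≤n : ∀ n c → maxMissing n c ≤ n
maxMissing≤n n c with maxMissing-sel n c
... | inj₁ eq       = ≤-trans (≤-reflexive eq) z≤n
... | inj₂ (m∈ , _) = proj₂ (∈-interval⁻ m∈)

-- The shape of the prefix of a sparse arrangement

-- Once an entry `x < α` occurs, `α` is still to its right and is its one larger entry. Everything
-- later in `c` is then at most `x`, so entries above `α` can only come first.
split-at-max : ∀ {α} c {w w′} → Sparse (c ++ w) → w ↭ α ∷ w′ → α ∉ c →
  ∃[ m ] m ≤ length c × All (α <_) (take m c) × All (_< α) (drop m c)
split-at-max []      _       _ _ = 0 , z≤n , [] , []
split-at-max {α} (x ∷ c) {w} {w′} (p ∷ s) ρ α∉ with <-cmp x α
... | tri< x<α _ _ = 0 , z≤n , [] ,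
  x<α ∷ All.map (λ y≤x → ≤-<-trans y≤x x<α)
    (All.++⁻ˡ c (AtMostOneAbove⇒all≤ x<α (↭-trans (++⁺ˡ c ρ) (shift α c w′)) p))
... | tri≈ _ x≡α _ = contradiction (here (sym x≡α)) α∉
... | tri> _ _ α<x with m , m≤ , hi , lo ← split-at-max c s ρ (α∉ ∘ there) =
  suc m , s≤s m≤ , α<x ∷ hi , lo

head-is-max : ∀ {x xs m} → All (_≤ x) xs → x ∷ xs ↭ applyDownFrom suc (suc m) → x ≡ suc m
head-is-max {m = m} xs≤x σ = ≤-antisym
  (All.lookup (All-applyDownFrom-suc (suc m)) (∈-resp-↭ σ (here refl)))
  (All.head (All-resp-↭ σ (≤-refl ∷ xs≤x)))

-- The first entry `x` of `q` has `α` to its right, so it bounds everything else in `q ++ w′`. As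
-- these are the values 1, ..., m, `x` must be m. Repeating this peels off m, m - 1, ... until `q`
-- is used up, and `k` values remain.
top-block : ∀ {α m} q {w w′} → Sparse (q ++ w) → w ↭ α ∷ w′ → All (_< α) q →
  q ++ w′ ↭ applyDownFrom suc m → ∃[ k ] m ≡ k + length q × q ≡ applyDownFrom (suc k +_) (length q)
top-block {m = m}    []      _ _ _ _ = m , sym (+-identityʳ m) , refl
top-block {m = zero} (x ∷ q) _ _ _ σ = contradiction σ ¬x∷xs↭[]
top-block {α} {suc m} (x ∷ q) {w′ = w′} (p ∷ s) ρ (x<α ∷ q<α) σ
  with refl ← head-is-max (AtMostOneAbove⇒all≤ x<α (↭-trans (++⁺ˡ q ρ) (shift α q w′)) p) σ
  with k , refl , q≡ ← top-block q s ρ q<α (drop-∷ σ) =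
  k , sym (+-suc k (length q)) , cong (suc (k + length q) ∷_) q≡

-- By `upper`, a value above `α` cannot be missing from `c`, and it cannot lie in `drop m c`, whose
-- entries are below `α`.
upper-block : ∀ {n α c w m} → Unique c → α ≤ n → c ++ w ↭ [ 1 ⋯ n ] →
  (∀ {x} → x ∈ [ 1 ⋯ n ] → x ∉ c → x ≤ α) →
  All (α <_) (take m c) → All (_< α) (drop m c) → take m c ↭ [ suc α ⋯ n ]
upper-block {n} {α} {c} {w} {m} c! α≤n π upper hi lo =
  unique∧set⇒↭ (Unique.take⁺ m c!) (interval-unique (suc α) n) (mk⇔ to from)
  where
  split : ∀ {x} → x ∈ c → x ∈ take m c ⊎ x ∈ drop m c
  split x∈c = ∈-++⁻ (take m c) (subst (_ ∈_) (sym (take++drop≡id m c)) x∈c)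
  to : ∀ {x} → x ∈ take m c → x ∈ [ suc α ⋯ n ]
  to x∈ = ∈-interval⁺ (All.lookup hi x∈) (proj₂ (∈-interval⁻ {1} (∈-resp-↭ π
    (∈-++⁺ˡ (subst (_ ∈_) (take++drop≡id m c) (∈-++⁺ˡ x∈))))))
  from : ∀ {x} → x ∈ [ suc α ⋯ n ] → x ∈ take m c
  from {x} x∈ with α<x , x≤n ← ∈-interval⁻ x∈
    with split (decidable-stable (_∈?_ _≟_ x c)
      (λ x∉c → <⇒≱ α<x (upper (∈-interval⁺ (≤-trans z<s α<x) x≤n) x∉c)))
  ... | inj₁ x∈p = x∈p
  ... | inj₂ x∈q = contradiction (All.lookup lo x∈q) (<⇒≯ α<x)

-- With `u` prefix entries above `α` and `l` in the descending block, the `n ∸ t` values left over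
-- are `α` and the `k` values below the block.
suffix-length : ∀ {n α t u l k} → α ≤ n → α ≡ suc (k + l) → u ≡ n ∸ α → t ≡ u + l → n ∸ t ≡ suc k
suffix-length {n} {α} {l = l} {k} α≤n refl refl refl = begin
  n ∸ (n ∸ α + l)           ≡⟨ ∸-+-assoc n (n ∸ α) l ⟨
  n ∸ (n ∸ α) ∸ l           ≡⟨ cong (_∸ l) (m∸[m∸n]≡n α≤n) ⟩
  suc k + l ∸ l             ≡⟨ m+n∸n≡m (suc k) l ⟩
  suc k                     ∎
  where open ≡-Reasoning

prefix-shape : ∀ {n α} c {w} → Unique c → α ∈ [ 1 ⋯ n ] → α ∉ c →
  (∀ {x} → x ∈ [ 1 ⋯ n ] → x ∉ c → x ≤ α) →
  c ++ w ↭ [ 1 ⋯ n ] → Sparse (c ++ w) →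
  take (n ∸ α) c ∼[ set ] [ suc α ⋯ n ] × drop (n ∸ α) c ≡ reverse [ n ∸ length c ⋯ α ∸ 1 ]
prefix-shape {α = zero} _ _ α∈ = contradiction (proj₁ (∈-interval⁻ {1} α∈)) λ ()
prefix-shape {n} {suc a} c {w} c! α∈ α∉ upper π s
  with α≤n ← proj₂ (∈-interval⁻ {1} α∈)
  -- `α` is missing from `c`, hence occurs in `w`; `w′` is the rest of `w`.
  with w′ , ρ ← ∈⇒↭∷ (Sum.[ (λ α∈c → contradiction α∈c α∉) , id ] (∈-++⁻ c (∈-resp-↭ (↭-sym π) α∈)))
  with m , m≤ , hi , lo ← split-at-max c s ρ α∉
  with p↭ ← upper-block {m = m} c! α≤n π upper hi lo
  -- Comparing lengths shows that the cut `m` is `n ∸ α`.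
  with refl ← trans (sym (trans (length-take m c) (m≤n⇒m⊓n≡m m≤)))
                    (trans (↭-length p↭) (length-interval (suc a) n)) =
  mk⇔ (∈-resp-↭ p↭) (∈-resp-↭ (↭-sym p↭)) , q-shape
  where
  p q : List ℕ
  p = take (n ∸ suc a) c
  q = drop (n ∸ suc a) c
  regroup : p ++ q ++ w ≡ c ++ w
  regroup = trans (sym (++-assoc p q w)) (cong (_++ w) (take++drop≡id (n ∸ suc a) c))
  -- Cancel the values above `α`, which make up `p`, and then `α` itself.
  σ : q ++ w′ ↭ applyDownFrom suc a
  σ = drop-∷ (↭-trans (↭-sym (shift (suc a) q w′)) (↭-trans (++⁺ˡ q (↭-sym ρ))
    (++-cancelˡ-↭ p (↭-trans (↭-reflexive regroup) (↭-trans π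
      (↭-trans (interval-↭ α≤n) (++⁺ʳ _ (↭-sym p↭))))))))
  q-shape : q ≡ reverse [ n ∸ length c ⋯ a ]
  q-shape with k , a≡ , q≡ ← top-block q (Sparse-++⁻ʳ p (subst Sparse (sym regroup) s)) ρ lo σ =
    begin
    q                                                  ≡⟨ q≡ ⟩
    applyDownFrom (suc k +_) (length q)                ≡⟨ cong₂ (λ u v → applyDownFrom (u +_) v) (sym n∸t) l≡ ⟩
    applyDownFrom (n ∸ length c +_) (suc a ∸ (n ∸ length c))
                                                       ≡⟨ reverse-interval (n ∸ length c) a ⟨
    reverse [ n ∸ length c ⋯ a ]                       ∎
    where
    open ≡-Reasoning
    n∸t : n ∸ length c ≡ suc k
    n∸t = suffix-length (proj₂ (∈-interval⁻ {1} α∈)) (cong suc a≡)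
      (trans (length-take _ c) (m≤n⇒m⊓n≡m m≤))
      (trans (cong length (sym (take++drop≡id (n ∸ suc a) c))) (length-++ p))
    l≡ : length q ≡ suc a ∸ (n ∸ length c)
    l≡ = sym (trans (cong₂ _∸_ (cong suc a≡) n∸t) (m+n∸m≡n k (length q)))

-- Since `c` is shorter than `n`, `w` has a first entry `z`. It is at least 1, and it is not in `c`
-- because the arrangement has no repetitions, so the maximum is not the default 0.
maxMissing-missing : ∀ {n} c {w} → length c < n → c ++ w ↭ [ 1 ⋯ n ] →
  maxMissing n c ∈ [ 1 ⋯ n ] × maxMissing n c ∉ c
maxMissing-missing {n} c {w} t<n π with maxMissing-sel n c | w
... | inj₂ m | _ = m
... | inj₁ _  | [] = contradiction (trans (sym (length-++ c)) (trans (↭-length π) (length-interval 0 n)))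
  (<⇒≢ (subst (_< n) (sym (+-identityʳ _)) t<n))
... | inj₁ α≡0 | z ∷ w′ =
  contradiction (≤-trans (proj₁ (∈-interval⁻ {1} z∈))
    (≤-trans (maxMissing-upper z∈ z∉c) (≤-reflexive α≡0))) λ ()
  where
  z∈ : z ∈ [ 1 ⋯ n ]
  z∈ = ∈-resp-↭ π (∈-insert c)
  z∉c : z ∉ c
  z∉c z∈c = All.lookup (AllPairs.head (AllPairs-resp-↭ {R = _≢_} (_∘ sym)
    (↭-trans (↭-sym π) (shift z c w′)) (interval-unique 1 n))) (∈-++⁺ˡ z∈c) refl

-- Extending a prefix of the right shape

Sparse-take : ∀ m {xs} → Sparse xs → Sparse (take m xs)
Sparse-take zero    _       = []
Sparse-take (suc m) []      = []
Sparse-take (suc m) (p ∷ s) = AllPairs.take⁺ m p ∷ Sparse-take m s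

-- What follows the first block entry is a permutation of α, l + k, ..., 1, where `l` counts the
-- later block entries. Among these only `α` exceeds that entry.
Sparse-block-++ : ∀ {α k w} l → l + k < α → w ↭ α ∷ applyDownFrom suc k → Sparse w →
  Sparse (applyDownFrom (suc k +_) l ++ w)
Sparse-block-++ zero _ _ s = s
Sparse-block-++ {α} {k} {w} (suc l) l+k<α ρ s =
  AtMostOneAbove-resp-↭ (↭-sym σ) (Descending⇒AtMostOneAbove
    ((l<α ∷ All.map (λ y≤ → ≤-<-trans y≤ (<-trans (n<1+n _) l+k<α))
              (All-applyDownFrom-suc (l + k)))
      ∷ subst (λ v → Descending (v ∷ applyDownFrom suc (l + k))) (cong suc (+-comm l k))
          (Descending-applyDownFrom-suc (suc (l + k)))))
  ∷ Sparse-block-++ l (<-trans (n<1+n _) l+k<α) ρ s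
  where
  l<α : suc (k + l) < α
  l<α = subst (_< α) (cong suc (+-comm l k)) l+k<α
  σ : applyDownFrom (suc k +_) l ++ w ↭ α ∷ applyDownFrom suc (l + k)
  σ = ↭-trans (++⁺ˡ _ ρ) (↭-trans (shift α (applyDownFrom (suc k +_) l) _)
    (↭-reflexive (cong (α ∷_) (applyDownFrom-suc-++ k l))))

shape⇒blocks : ∀ {n α} c → Unique c → length c < n → α ≤ n →
  take (n ∸ α) c ∼[ set ] [ suc α ⋯ n ] → drop (n ∸ α) c ≡ reverse [ n ∸ length c ⋯ α ∸ 1 ] →
  ∃[ k ] ∃[ l ] n ∸ length c ≡ suc k × α ≡ suc (l + k) ×
    take (n ∸ α) c ↭ [ suc α ⋯ n ] × drop (n ∸ α) c ≡ applyDownFrom (suc k +_) l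
shape⇒blocks {n} {α} c c! t<n α≤n p∼ q≡
  with p↭ ← unique∧set⇒↭ (Unique.take⁺ (n ∸ α) c!) (interval-unique (suc α) n) p∼
  -- `c` is long enough to hold all values above `α`. Hence `n ∸ length c ≤ α`, and the difference
  -- is the block length `l`.
  with n∸α≤t ← m⊓n≡m⇒m≤n {n ∸ α} (trans (sym (length-take _ c)) (trans (↭-length p↭) (length-interval α n)))
  with k , 1+k≡ ← m≤n⇒∃[o]m+o≡n (m<n⇒0<n∸m t<n)
  with l , refl ← m≤n⇒∃[o]m+o≡n
    (subst (_≤ α) (sym 1+k≡) (≤-trans (∸-monoʳ-≤ n n∸α≤t) (≤-reflexive (m∸[m∸n]≡n α≤n)))) =
  k , l , sym 1+k≡ , cong suc (+-comm k l) , p↭ , (begin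
    drop (n ∸ suc (k + l)) c                     ≡⟨ q≡ ⟩
    reverse [ n ∸ length c ⋯ k + l ]             ≡⟨ cong (λ u → reverse [ u ⋯ k + l ]) 1+k≡ ⟨
    reverse [ suc k ⋯ k + l ]                    ≡⟨ reverse-interval (suc k) (k + l) ⟩
    applyDownFrom (suc k +_) (k + l ∸ k)         ≡⟨ cong (applyDownFrom (suc k +_)) (m+n∸m≡n k l) ⟩
    applyDownFrom (suc k +_) l                   ∎)
  where open ≡-Reasoning

-- The prefix is `p ++ q`; `r` lists the values left over in descending order, as `sparsePerms`
-- expects them.
module _ {n α k l} (p : List ℕ) (α≤n : α ≤ n) (α≡ : α ≡ suc (l + k)) (p↭ : p ↭ [ suc α ⋯ n ]) where

  private
    q r : List ℕ
    q = applyDownFrom (suc k +_) l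
    r = α ∷ applyDownFrom suc k

  block-↭ : q ++ r ↭ applyDownFrom suc α
  block-↭ = begin
    q ++ r                             ↭⟨ shift α q _ ⟩
    α ∷ q ++ applyDownFrom suc k       ≡⟨ cong₂ _∷_ α≡ (applyDownFrom-suc-++ k l) ⟩
    applyDownFrom suc (suc (l + k))    ≡⟨ cong (applyDownFrom suc) α≡ ⟨
    applyDownFrom suc α                ∎
    where open PermutationReasoning

  completion-↭ : (p ++ q) ++ r ↭ [ 1 ⋯ n ]
  completion-↭ = begin
    (p ++ q) ++ r                         ≡⟨ ++-assoc p q r ⟩
    p ++ q ++ r                           ↭⟨ ++⁺ˡ p block-↭ ⟩
    p ++ applyDownFrom suc α              ↭⟨ ++⁺ʳ _ p↭ ⟩
    [ suc α ⋯ n ] ++ applyDownFrom suc α  ↭⟨ interval-↭ α≤n ⟨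
    [ 1 ⋯ n ]                             ∎
    where open PermutationReasoning

  completion-descending : Descending r
  completion-descending =
    All.map (λ y≤k → subst (_ <_) (sym α≡) (s≤s (≤-trans y≤k (m≤n+m k l)))) (All-applyDownFrom-suc k)
    ∷ Descending-applyDownFrom-suc k

  -- Every entry of `p` exceeds `α`, and `q ++ w` has no entry above `α`, so `p` and `q ++ w` can be
  -- treated separately.
  completion-sparse : ∀ {w} → Sparse p → w ↭ r → Sparse w → Sparse ((p ++ q) ++ w)
  completion-sparse {w} sp ρ sw = subst Sparse (sym (++-assoc p q w))
    (Sparse-++⁺ sp (Sparse-block-++ l (≤-reflexive (sym α≡)) ρ sw)
      (All.map (λ α<x → All.map (λ y≤α → ≤-trans y≤α (<⇒≤ α<x)) rest≤α)
        (All-resp-↭ (↭-sym p↭) (All.tabulate (λ x∈ → proj₁ (∈-interval⁻ {suc α} x∈))))))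
    where
    rest≤α : All (_≤ α) (q ++ w)
    rest≤α = All-resp-↭ (↭-sym (↭-trans (++⁺ˡ q ρ) block-↭)) (All-applyDownFrom-suc α)

-- Counting

take-length-++ : (xs ys : List A) → take (length xs) (xs ++ ys) ≡ xs
take-length-++ []       ys = refl
take-length-++ (x ∷ xs) ys = cong (x ∷_) (take-length-++ xs ys)

S⇔Sparse-extension : ∀ {n c τ} → S n c (p123 ∷ p132 ∷ []) τ ⇔
  (∃[ w ] τ ≡ c ++ w × c ++ w ↭ [ 1 ⋯ n ] × Sparse (c ++ w))
S⇔Sparse-extension {n} {c} {τ} = mk⇔ to from
  where
  to : S n c (p123 ∷ p132 ∷ []) τ → ∃[ w ] τ ≡ c ++ w × c ++ w ↭ [ 1 ⋯ n ] × Sparse (c ++ w)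
  to (π , take≡ , ¬123 ∷ ¬132 ∷ []) =
    drop (length c) τ , τ≡ , subst (_↭ [ 1 ⋯ n ]) τ≡ π , subst Sparse τ≡ (Avoids⇒Sparse τ ¬123 ¬132)
    where
    τ≡ : τ ≡ c ++ drop (length c) τ
    τ≡ = trans (sym (take++drop≡id (length c) τ)) (cong (_++ drop (length c) τ) take≡)
  from : (∃[ w ] τ ≡ c ++ w × c ++ w ↭ [ 1 ⋯ n ] × Sparse (c ++ w)) → S n c (p123 ∷ p132 ∷ []) τ
  from (w , refl , π , s) = π , take-length-++ c w ,
    Sparse⇒Avoids s (s<s z<s) (s<s z<s) ∷ Sparse⇒Avoids s (s<s z<s) (s<s z<s) ∷ []

empty⇒∣∣≡0 : {P : A → Set} → (∀ x → ¬ P x) → ∣ P ∣≡ 0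
empty⇒∣∣≡0 ¬P = [] , [] , (λ x → mk⇔ (λ ()) (λ Px → contradiction Px (¬P x))) , refl

-- The completions of `c` are exactly the sparse arrangements of α, k, ..., 1, where `n ∸ length c`
-- is `suc k`.
shape⇒count : ∀ {n α} c → Unique c → Sparse c → length c < n → α ≤ n →
  take (n ∸ α) c ∼[ set ] [ suc α ⋯ n ] → drop (n ∸ α) c ≡ reverse [ n ∸ length c ⋯ α ∸ 1 ] →
  ∣ S n c (p123 ∷ p132 ∷ []) ∣≡ (2 ^ (n ∸ length c ∸ 1))
shape⇒count {n} {α} c c! sc t<n α≤n p∼ q≡
  with k , l , n∸t≡1+k , α≡ , p↭ , q≡′ ← shape⇒blocks c c! t<n α≤n p∼ q≡ =
  map (c ++_) (sparsePerms α (applyDownFrom suc k)) ,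
  Unique.map⁺ (++-cancelˡ c _ _) (sparsePerms-unique α _ descending) ,
  (λ τ → mk⇔ (to τ) (from τ)) ,
  (begin
    length (map (c ++_) (sparsePerms α (applyDownFrom suc k)))
      ≡⟨ length-map _ (sparsePerms α (applyDownFrom suc k)) ⟩
    length (sparsePerms α (applyDownFrom suc k))
      ≡⟨ length-sparsePerms α (applyDownFrom suc k) ⟩
    2 ^ length (applyDownFrom suc k)
      ≡⟨ cong (2 ^_) (length-applyDownFrom suc k) ⟩
    2 ^ k
      ≡⟨ cong (λ u → 2 ^ (u ∸ 1)) n∸t≡1+k ⟨
    2 ^ (n ∸ length c ∸ 1) ∎)
  where
  open ≡-Reasoning
  p : List ℕ
  p = take (n ∸ α) c
  c≡ : p ++ applyDownFrom (suc k +_) l ≡ c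
  c≡ = trans (cong (p ++_) (sym q≡′)) (take++drop≡id (n ∸ α) c)
  descending : Descending (α ∷ applyDownFrom suc k)
  descending = completion-descending p α≤n α≡ p↭
  π : c ++ α ∷ applyDownFrom suc k ↭ [ 1 ⋯ n ]
  π = subst (λ c′ → c′ ++ _ ↭ [ 1 ⋯ n ]) c≡ (completion-↭ p α≤n α≡ p↭)
  to : ∀ τ → τ ∈ map (c ++_) (sparsePerms α (applyDownFrom suc k)) → S n c (p123 ∷ p132 ∷ []) τ
  to τ τ∈ with w , w∈ , τ≡ ← ∈-map⁻ _ τ∈
    with ρ , sw ← sparsePerms-sound α _ descending w∈ =
    Equivalence.from S⇔Sparse-extension
      ( w , τ≡ , ↭-trans (++⁺ˡ c ρ) π
      , subst (λ c′ → Sparse (c′ ++ w)) c≡ (completion-sparse p α≤n α≡ p↭ (Sparse-take (n ∸ α) sc) ρ sw) )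
  from : ∀ τ → S n c (p123 ∷ p132 ∷ []) τ → τ ∈ map (c ++_) (sparsePerms α (applyDownFrom suc k))
  from τ Sτ with w , refl , π′ , s ← Equivalence.to S⇔Sparse-extension Sτ =
    ∈-map⁺ _ (sparsePerms-complete α _ descending (++-cancelˡ-↭ c (↭-trans π′ (↭-sym π))) (Sparse-++⁻ʳ c s))

-- The reversed interval is α - 1, ..., n - t, which is empty when α = n - t.
theorem5p4 : (n t : ℕ) (c : List ℕ) → 3 ≤ n → 1 ≤ t → t < n →
    length c ≡ t → All (_∈ [ 1 ⋯ n ]) c → Unique c →
    c Avoids p123 → c Avoids p132 →
    let α = maxMissing n c in
    ((¬ (take (n ∸ α) c ∼[ set ] [ suc α ⋯ n ]) ⊎
    drop (n ∸ α) c ≢ reverse [ n ∸ t ⋯ α ∸ 1 ]) →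
    ∣ S n c (p123 ∷ p132 ∷ []) ∣≡ 0) ×
    ((take (n ∸ α) c ∼[ set ] [ suc α ⋯ n ] ×
    drop (n ∸ α) c ≡ reverse [ n ∸ t ⋯ α ∸ 1 ]) →
    ∣ S n c (p123 ∷ p132 ∷ []) ∣≡ (2 ^ (n ∸ t ∸ 1)))
theorem5p4 n t c _ _ t<n refl _ c! ¬123 ¬132 =
  -- A single element of the set would already force the prefix into the right shape.
  (λ misshaped → empty⇒∣∣≡0 (λ τ Sτ → refute misshaped (shaped Sτ))) ,
  (λ (p∼ , q≡) → shape⇒count c c! (Avoids⇒Sparse c ¬123 ¬132) t<n (maxMissing≤n n c) p∼ q≡)
  where
  refute : {P Q : Set} → ¬ P ⊎ ¬ Q → ¬ (P × Q)
  refute (inj₁ ¬P) (P , _) = ¬P P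
  refute (inj₂ ¬Q) (_ , Q) = ¬Q Q
  shaped : ∀ {τ} → S n c (p123 ∷ p132 ∷ []) τ →
    take (n ∸ maxMissing n c) c ∼[ set ] [ suc (maxMissing n c) ⋯ n ] ×
    drop (n ∸ maxMissing n c) c ≡ reverse [ n ∸ length c ⋯ maxMissing n c ∸ 1 ]
  shaped Sτ with w , _ , π , s ← Equivalence.to S⇔Sparse-extension Sτ
    with α∈ , α∉ ← maxMissing-missing c t<n π = prefix-shape c c! α∈ α∉ maxMissing-upper π s
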